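{- Let $\Lambda\subset\mathbb{N}$ be a finite saturated set. Then $\Phi_\Lambda(x^n)$ is a strong divisibility sequence of polynomials if and only if $\Lambda=\langle N\rangle$ for some $N\geq 1$.
   Context: $\mathbb{N}$ denotes the positive integers. A set $\Lambda\subset\mathbb{N}$ is saturated if $d\mid h$ and $h\in\Lambda$ imply $d\in\Lambda$. $\langle N\rangle$ denotes the set of all positive divisors of the positive integer $N$. $\Phi_d(x)$ is the $d$-th cyclotomic polynomial and $\Phi_\Lambda(x):=\prod_{d\in\Lambda}\Phi_d(x)$. A sequence of polynomials $f_n(x)$, $n\geq1$ (here $f_n(x)=\Phi_\Lambda(x^n)$), is a strong divisibility sequence if $\gcd(f_m,f_n)=f_{\gcd(m,n)}$ for all positive integers $m,n$.
   Formalization: The finite saturated set Λ is additionally required to be nonempty: for Λ = ∅ the product is 1, a constant strong divisibility sequence, while ∅ is not ⟨N⟩ for any N ≥ 1. -}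

module Defs where

open import Algebra.Bundles.Raw using (RawMagma)
open import Data.Bool.Base using (if_then_else_)
open import Data.Integer.Base as ℤ using (ℤ; 0ℤ; 1ℤ; -1ℤ)
import Data.Integer.Properties as ℤ using (_≟_)
open import Data.List.Base using (List; []; _∷_; map; foldr; length; replicate; _++_)
open import Data.List.Membership.Propositional using (_∈_)
open import Data.Nat.Base using (ℕ; zero; suc; pred; NonZero)
import Data.Nat.Divisibility as ℕ
import Data.Nat.GCD as ℕ
open import Data.Product.Base using (_×_; _,_; proj₁)
open import Level using (0ℓ)
open import Relation.Binary.PropositionalEquality.Core using (_≡_)
open import Relation.Nullary.Decidable.Core using (does)
open import Relation.Unary using (Pred)

-- Polynomials over ℤ, constant coefficient first.  Trailing zeros are
-- allowed, so equality of polynomials is _≈_ rather than _≡_.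
Poly : Set
Poly = List ℤ

coeff : Poly → ℕ → ℤ
coeff []      _       = 0ℤ
coeff (a ∷ p) zero    = a
coeff (a ∷ p) (suc i) = coeff p i

-- A record rather than a plain function type, so that p and q can be
-- inferred from a proof of p ≈ q.
infix 4 _≈_
record _≈_ (p q : Poly) : Set where
  constructor mk≈
  field
    coeff-≡ : ∀ i → coeff p i ≡ coeff q i

infixl 6 _+_ _-_
infixl 7 _*_ _·_

_+_ : Poly → Poly → Poly
[]      + q       = q
(a ∷ p) + []      = a ∷ p
(a ∷ p) + (b ∷ q) = (a ℤ.+ b) ∷ (p + q)

_·_ : ℤ → Poly → Poly
c · p = map (c ℤ.*_) p

_-_ : Poly → Poly → Poly
p - q = p + -1ℤ · q

_*_ : Poly → Poly → Poly
[]      * q = []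
(a ∷ p) * q = a · q + (0ℤ ∷ p * q)

1ₚ : Poly
1ₚ = 1ℤ ∷ []

infix 8 X^_
X^_ : ℕ → Poly
X^ n = replicate n 0ℤ ++ 1ₚ

product : List Poly → Poly
product = foldr _*_ 1ₚ

-- Composition: p ∘ q is p(q(x)).
infixr 9 _∘_
_∘_ : Poly → Poly → Poly
[]      ∘ q = []
(a ∷ p) ∘ q = (a ∷ []) + q * (p ∘ q)

*-rawMagma : RawMagma 0ℓ 0ℓ
*-rawMagma = record { Carrier = Poly ; _≈_ = _≈_ ; _∙_ = _*_ }

open import Algebra.Definitions.RawMagma *-rawMagma public using (_∣_)

-- d is a greatest common divisor of p and q in ℤ[x], which determines d up
-- to sign.
record GCD (p q d : Poly) : Set where
  constructor is
  field
    commonDivisor : d ∣ p × d ∣ q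
    greatest      : ∀ {e} → e ∣ p × e ∣ q → e ∣ d

consTrim : ℤ → Poly → Poly
consTrim a []      = if does (a ℤ.≟ 0ℤ) then [] else a ∷ []
consTrim a (b ∷ p) = a ∷ b ∷ p

-- Removes trailing zeros.
trim : Poly → Poly
trim = foldr consTrim []

-- The zero polynomial gets degree 0.
degree : Poly → ℕ
degree p = pred (length (trim p))

-- For q monic, quotRem p q is the pair (s , r) with p = s q + r and r zero
-- or of degree less than that of q.  If p = s q + r then
-- a + x p = (x s + c) q + ((a + x r) - c q), and c, the coefficient of
-- a + x r at the degree of q, cancels the leading term.  The value is not
-- meaningful when q is not monic.
quotRem : Poly → Poly → Poly × Poly
quotRem []      q = [] , []
quotRem (a ∷ p) q =
  let (s , r) = quotRem p q
      c       = coeff (a ∷ r) (degree q)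
  in c ∷ s , (a ∷ r) - c · q

infixl 7 _quot_
_quot_ : Poly → Poly → Poly
p quot q = proj₁ (quotRem p q)

-- Φ n is the n-th cyclotomic polynomial, determined recursively by
-- xⁿ - 1 = ∏_{d ∣ n} Φ_d.  The division is exact and its divisor monic.
-- Φ 0 is a dummy value.
Φ : ℕ → Poly

-- ∏Φ n m is the product of the Φ_d over the divisors d of n with 1 ≤ d ≤ m.
∏Φ : ℕ → ℕ → Poly

Φ zero    = 1ₚ
Φ (suc n) = (X^ suc n - 1ₚ) quot ∏Φ (suc n) n

∏Φ n zero    = 1ₚ
∏Φ n (suc m) = if does (suc m ℕ.∣? n) then Φ (suc m) * ∏Φ n m else ∏Φ n m

-- The product over the set enumerated by Λ, provided Λ has no repetitions.
Φ[_] : List ℕ → Poly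
Φ[ Λ ] = product (map Φ Λ)

-- The empty set is saturated and Φ[ [] ] = 1 gives a constant strong
-- divisibility sequence, although [] is no ⟨ N ⟩; hence theorems about
-- saturated sets may have to exclude it.
Saturated : List ℕ → Set
Saturated Λ = ∀ {d h} → d ℕ.∣ h → h ∈ Λ → d ∈ Λ

⟨_⟩ : ℕ → Pred ℕ 0ℓ
⟨ N ⟩ d = NonZero d × d ℕ.∣ N

-- Sequences are indexed by the positive integers; f 0 is irrelevant.
StrongDivisibilitySequence : (ℕ → Poly) → Set
StrongDivisibilitySequence f =
  ∀ m n → .{{NonZero m}} → .{{NonZero n}} → GCD (f m) (f n) (f (ℕ.gcd m n))

{-# OPTIONS --safe #-}

-- Everything rests on one coprimality statement: if k ∤ j, the ideal
-- (Φ_k, x^j - 1) of ℤ[x] contains a nonzero integer.  It makes distinct Φ_d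
-- coprime over ℚ, so a polynomial divisible by Φ_d for every d in a finite set
-- is divisible by the product of these (monic) Φ_d, and no roots or field
-- extensions are needed.
--
-- If Λ = ⟨ N ⟩, then Φ_Λ(x^n) is x^(Nn) - 1 up to associates, and the gcd is
-- given by Bézout's identity for the exponents.  Conversely, let a, b ∈ Λ and
-- write k = lcm(a, b) = ma = nb with m and n coprime.  Then Φ_k divides
-- Φ_a(x^m) and Φ_b(x^n), hence it divides Φ_Λ(x), and so k ∈ Λ because Φ_k is
-- not constant.  Thus Λ is closed under lcm, and N is the lcm of its elements.
module Submission where

open import Defs
open import Algebra.Bundles using (AbelianGroup; CommutativeRing)
import Algebra.Properties.CommutativeSemigroup as CommutativeSemigroupProperties
open import Data.Bool.Base using (true; false)
open import Data.Integer.Base as ℤ using (ℤ; 0ℤ; 1ℤ; -1ℤ)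
import Data.Integer.Properties as ℤ
open import Data.List.Base using (List; []; _∷_; length; filter; foldr; applyDownFrom)
open import Data.List.Membership.Propositional using (_∈_)
open import Data.List.Membership.Propositional.Properties
  using (∈-filter⁺; ∈-filter⁻; ∈-applyDownFrom⁺; ∈-applyDownFrom⁻)
open import Data.List.Properties using (filter-accept)
open import Data.List.Relation.Unary.All as All using (All; []; _∷_)
open import Data.List.Relation.Unary.AllPairs using (_∷_)
open import Data.List.Relation.Unary.Any using (here; there)
open import Data.List.Relation.Unary.Unique.Propositional using (Unique)
import Data.List.Relation.Unary.Unique.Propositional.Properties as Unique
open import Data.Maybe.Base using (Maybe; just; nothing)
open import Data.Nat.Base as ℕ using (ℕ; zero; suc; NonZero; NonTrivial; z≤n; s≤s)
import Data.Nat.Divisibility as ℕ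
import Data.Nat.GCD as ℕ
open import Data.Nat.Induction using (<-wellFounded)
import Data.Nat.LCM as ℕ
import Data.Nat.ListAction as ℕ using (product)
open import Data.Nat.Primality
  using (Prime; euclidsLemma; prime⇒nonZero; prime⇒nonTrivial; productOfPrimes≢0)
open import Data.Nat.Primality.Factorisation using (PrimeFactorisation; factorise)
import Data.Nat.Properties as ℕ
open import Data.List.Membership.DecPropositional ℕ._≟_ using (_∈?_)
open import Data.Product.Base using (_×_; _,_; proj₁; proj₂; ∃-syntax)
open import Data.Sum.Base using (_⊎_; inj₁; inj₂; [_,_]′)
open import Function.Bundles using (_⇔_; mk⇔)
open import Induction.WellFounded using (Acc; acc)
open import Level using (0ℓ)
open import Relation.Binary.Definitions using (tri<; tri≈; tri>)
open import Relation.Binary.PropositionalEquality.Core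
  using (_≡_; _≢_; refl; sym; trans; cong; cong₂; subst; subst₂)
open import Relation.Binary.PropositionalEquality.Properties using (module ≡-Reasoning)
import Relation.Binary.Reasoning.Setoid as ≈-Reasoning
open import Relation.Binary.Structures using (IsEquivalence)
open import Relation.Nullary.Decidable using (Dec; yes; no; does; ¬?; _×-dec_)
open import Relation.Nullary.Negation using (¬_; contradiction)
open import Relation.Unary using (Pred; _≐_)
open import Tactic.RingSolver using (solve-∀)
open import Tactic.RingSolver.Core.AlmostCommutativeRing
  using (AlmostCommutativeRing; fromCommutativeRing)

open _≈_

-- The ring ℤ[x]

≈-isEquivalence : IsEquivalence _≈_
≈-isEquivalence = record
  { refl  = mk≈ λ _ → refl
  ; sym   = λ p≈q → mk≈ λ i → sym (coeff-≡ p≈q i)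
  ; trans = λ p≈q q≈r → mk≈ λ i → trans (coeff-≡ p≈q i) (coeff-≡ q≈r i)
  }

open IsEquivalence ≈-isEquivalence using ()
  renaming (refl to ≈-refl; sym to ≈-sym; trans to ≈-trans; reflexive to ≈-reflexive)

∷-cong : ∀ {a b p q} → a ≡ b → p ≈ q → a ∷ p ≈ b ∷ q
∷-cong a≡b p≈q = mk≈ λ { zero → a≡b ; (suc i) → coeff-≡ p≈q i }

∷≈[] : ∀ {a p} → a ≡ 0ℤ → p ≈ [] → a ∷ p ≈ []
∷≈[] a≡0 p≈[] = mk≈ λ { zero → a≡0 ; (suc i) → coeff-≡ p≈[] i }

∷-injectiveʳ : ∀ {a b p q} → a ∷ p ≈ b ∷ q → p ≈ q
∷-injectiveʳ eq = mk≈ λ i → coeff-≡ eq (suc i)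

∷≈[]⇒≈[] : ∀ {a p} → a ∷ p ≈ [] → p ≈ []
∷≈[]⇒≈[] eq = mk≈ λ i → coeff-≡ eq (suc i)

coeff-+ : ∀ p q i → coeff (p + q) i ≡ coeff p i ℤ.+ coeff q i
coeff-+ []      q       i       = sym (ℤ.+-identityˡ _)
coeff-+ (a ∷ p) []      i       = sym (ℤ.+-identityʳ _)
coeff-+ (a ∷ p) (b ∷ q) zero    = refl
coeff-+ (a ∷ p) (b ∷ q) (suc i) = coeff-+ p q i

coeff-· : ∀ c p i → coeff (c · p) i ≡ c ℤ.* coeff p i
coeff-· c []      i       = sym (ℤ.*-zeroʳ c)
coeff-· c (a ∷ p) zero    = refl
coeff-· c (a ∷ p) (suc i) = coeff-· c p i

+-cong : ∀ {p p′ q q′} → p ≈ p′ → q ≈ q′ → p + q ≈ p′ + q′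
+-cong {p} {p′} {q} {q′} p≈p′ q≈q′ = mk≈ λ i →
  trans (coeff-+ p q i)
    (trans (cong₂ ℤ._+_ (coeff-≡ p≈p′ i) (coeff-≡ q≈q′ i)) (sym (coeff-+ p′ q′ i)))

·-cong : ∀ c {p q} → p ≈ q → c · p ≈ c · q
·-cong c {p} {q} p≈q = mk≈ λ i →
  trans (coeff-· c p i) (trans (cong (c ℤ.*_) (coeff-≡ p≈q i)) (sym (coeff-· c q i)))

+-assoc : ∀ p q r → (p + q) + r ≈ p + (q + r)
+-assoc []      q       r       = ≈-refl
+-assoc (a ∷ p) []      r       = ≈-refl
+-assoc (a ∷ p) (b ∷ q) []      = ≈-refl
+-assoc (a ∷ p) (b ∷ q) (c ∷ r) = ∷-cong (ℤ.+-assoc a b c) (+-assoc p q r)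

+-comm : ∀ p q → p + q ≈ q + p
+-comm []      []      = ≈-refl
+-comm []      (b ∷ q) = ≈-refl
+-comm (a ∷ p) []      = ≈-refl
+-comm (a ∷ p) (b ∷ q) = ∷-cong (ℤ.+-comm a b) (+-comm p q)

+-identityʳ : ∀ p → p + [] ≈ p
+-identityʳ p = +-comm p []

-‿inverseʳ : ∀ p → p - p ≈ []
-‿inverseʳ []      = ≈-refl
-‿inverseʳ (a ∷ p) = ∷≈[] (trans (cong₂ ℤ._+_ (refl {x = a}) (ℤ.-1*i≡-i a)) (ℤ.+-inverseʳ a)) (-‿inverseʳ p)

+-abelianGroup : AbelianGroup 0ℓ 0ℓ
+-abelianGroup = record
  { Carrier = Poly
  ; _≈_     = _≈_
  ; _∙_     = _+_
  ; ε       = []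
  ; _⁻¹     = -1ℤ ·_
  ; isAbelianGroup = record
    { isGroup = record
      { isMonoid = record
        { isSemigroup = record
          { isMagma = record { isEquivalence = ≈-isEquivalence ; ∙-cong = +-cong }
          ; assoc   = +-assoc
          }
        ; identity = (λ _ → ≈-refl) , +-identityʳ
        }
      ; inverse = (λ p → ≈-trans (+-comm (-1ℤ · p) p) (-‿inverseʳ p)) , -‿inverseʳ
      ; ⁻¹-cong = ·-cong -1ℤ
      }
    ; comm = +-comm
    }
  }

open AbelianGroup +-abelianGroup using (setoid) renaming (∙-congˡ to +-congˡ; ∙-congʳ to +-congʳ)
open CommutativeSemigroupProperties (AbelianGroup.commutativeSemigroup +-abelianGroup)
  using (interchange; x∙yz≈y∙xz)

·-distribˡ-+ : ∀ c p q → c · (p + q) ≈ c · p + c · q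
·-distribˡ-+ c []      q       = ≈-refl
·-distribˡ-+ c (a ∷ p) []      = ≈-refl
·-distribˡ-+ c (a ∷ p) (b ∷ q) = ∷-cong (ℤ.*-distribˡ-+ c a b) (·-distribˡ-+ c p q)

·-distribʳ-+ : ∀ p c d → (c ℤ.+ d) · p ≈ c · p + d · p
·-distribʳ-+ []      c d = ≈-refl
·-distribʳ-+ (a ∷ p) c d = ∷-cong (ℤ.*-distribʳ-+ a c d) (·-distribʳ-+ p c d)

·-assoc : ∀ c d p → (c ℤ.* d) · p ≈ c · (d · p)
·-assoc c d []      = ≈-refl
·-assoc c d (a ∷ p) = ∷-cong (ℤ.*-assoc c d a) (·-assoc c d p)

·-identity : ∀ p → 1ℤ · p ≈ p
·-identity []      = ≈-refl
·-identity (a ∷ p) = ∷-cong (ℤ.*-identityˡ a) (·-identity p)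

·-zeroˡ : ∀ p → 0ℤ · p ≈ []
·-zeroˡ []      = ≈-refl
·-zeroˡ (a ∷ p) = ∷≈[] refl (·-zeroˡ p)

*-congˡ : ∀ p {q q′} → q ≈ q′ → p * q ≈ p * q′
*-congˡ []      q≈q′ = ≈-refl
*-congˡ (a ∷ p) q≈q′ = +-cong (·-cong a q≈q′) (∷-cong refl (*-congˡ p q≈q′))

*-zeroʳ : ∀ p → p * [] ≈ []
*-zeroʳ []      = ≈-refl
*-zeroʳ (a ∷ p) = ∷≈[] refl (*-zeroʳ p)

-- Multiplication recurses on its left factor; this is the mirrored recursion, from which
-- commutativity follows by induction.
*-∷ : ∀ p b q → p * (b ∷ q) ≈ b · p + (0ℤ ∷ p * q)
*-∷ []      b q = ≈-sym (∷≈[] refl ≈-refl)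
*-∷ (a ∷ p) b q = ∷-cong (cong (ℤ._+ 0ℤ) (ℤ.*-comm a b)) (begin
  a · q + p * (b ∷ q)             ≈⟨ +-congˡ (*-∷ p b q) ⟩
  a · q + (b · p + (0ℤ ∷ p * q))  ≈⟨ x∙yz≈y∙xz (a · q) (b · p) (0ℤ ∷ p * q) ⟩
  b · p + (a · q + (0ℤ ∷ p * q))  ∎)
  where open ≈-Reasoning setoid

*-comm : ∀ p q → p * q ≈ q * p
*-comm p []      = *-zeroʳ p
*-comm p (b ∷ q) = ≈-trans (*-∷ p b q) (+-congˡ (∷-cong refl (*-comm p q)))

-- The left factor is handled through commutativity, because equal polynomials may be lists of
-- different lengths and do not recurse in step.
*-cong : ∀ {p p′ q q′} → p ≈ p′ → q ≈ q′ → p * q ≈ p′ * q′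
*-cong {p} {p′} {q} {q′} p≈p′ q≈q′ = begin
  p * q    ≈⟨ *-congˡ p q≈q′ ⟩
  p * q′   ≈⟨ *-comm p q′ ⟩
  q′ * p   ≈⟨ *-congˡ q′ p≈p′ ⟩
  q′ * p′  ≈⟨ *-comm q′ p′ ⟩
  p′ * q′  ∎
  where open ≈-Reasoning setoid

*-distribʳ-+ : ∀ q p p′ → (p + p′) * q ≈ p * q + p′ * q
*-distribʳ-+ q []      p′       = ≈-refl
*-distribʳ-+ q (a ∷ p) []       = ≈-sym (+-identityʳ _)
*-distribʳ-+ q (a ∷ p) (b ∷ p′) = begin
  (a ℤ.+ b) · q + (0ℤ ∷ (p + p′) * q)
    ≈⟨ +-cong (·-distribʳ-+ q a b) (∷-cong refl (*-distribʳ-+ q p p′)) ⟩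
  (a · q + b · q) + ((0ℤ ∷ p * q) + (0ℤ ∷ p′ * q))
    ≈⟨ interchange (a · q) (b · q) (0ℤ ∷ p * q) (0ℤ ∷ p′ * q) ⟩
  (a · q + (0ℤ ∷ p * q)) + (b · q + (0ℤ ∷ p′ * q)) ∎
  where open ≈-Reasoning setoid

·-*-assoc : ∀ c p q → (c · p) * q ≈ c · (p * q)
·-*-assoc c []      q = ≈-refl
·-*-assoc c (a ∷ p) q = begin
  (c ℤ.* a) · q + (0ℤ ∷ (c · p) * q)
    ≈⟨ +-cong (·-assoc c a q) (∷-cong (sym (ℤ.*-zeroʳ c)) (·-*-assoc c p q)) ⟩
  c · (a · q) + c · (0ℤ ∷ p * q)
    ≈⟨ ·-distribˡ-+ c (a · q) (0ℤ ∷ p * q) ⟨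
  c · (a · q + (0ℤ ∷ p * q)) ∎
  where open ≈-Reasoning setoid

0∷-* : ∀ p q → (0ℤ ∷ p) * q ≈ 0ℤ ∷ p * q
0∷-* p q = +-congʳ (·-zeroˡ q)

*-assoc : ∀ p q r → (p * q) * r ≈ p * (q * r)
*-assoc []      q r = ≈-refl
*-assoc (a ∷ p) q r = begin
  (a · q + (0ℤ ∷ p * q)) * r         ≈⟨ *-distribʳ-+ r (a · q) (0ℤ ∷ p * q) ⟩
  (a · q) * r + (0ℤ ∷ p * q) * r     ≈⟨ +-cong (·-*-assoc a q r) (0∷-* (p * q) r) ⟩
  a · (q * r) + (0ℤ ∷ (p * q) * r)   ≈⟨ +-congˡ (∷-cong refl (*-assoc p q r)) ⟩
  a · (q * r) + (0ℤ ∷ p * (q * r))   ∎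
  where open ≈-Reasoning setoid

constant-* : ∀ c p → (c ∷ []) * p ≈ c · p
constant-* c p = ≈-trans (+-congˡ (∷≈[] refl ≈-refl)) (+-identityʳ (c · p))

*-identityˡ : ∀ p → 1ₚ * p ≈ p
*-identityˡ p = ≈-trans (constant-* 1ℤ p) (·-identity p)

polyRing : CommutativeRing 0ℓ 0ℓ
polyRing = record
  { Carrier = Poly
  ; _≈_ = _≈_
  ; _+_ = _+_
  ; _*_ = _*_
  ; -_  = -1ℤ ·_
  ; 0#  = []
  ; 1#  = 1ₚ
  ; isCommutativeRing = record
    { isRing = record
      { +-isAbelianGroup = AbelianGroup.isAbelianGroup +-abelianGroup
      ; *-cong     = *-cong
      ; *-assoc    = *-assoc
      ; *-identity = *-identityˡ , λ p → ≈-trans (*-comm p 1ₚ) (*-identityˡ p)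
      ; distrib    =
          (λ p q r → ≈-trans (*-comm p (q + r))
            (≈-trans (*-distribʳ-+ p q r) (+-cong (*-comm q p) (*-comm r p))))
        , *-distribʳ-+
      }
    ; *-comm = *-comm
    }
  }

open import Algebra.Properties.CommutativeSemigroup.Divisibility
  (CommutativeRing.*-commutativeSemigroup polyRing)
  using (_,_; ∣ʳ-trans; ∣ʳ-respʳ-≈; ∣ʳ-respˡ-≈; x∣ʳy⇒x∣ʳzy; x∣ʳy⇒xz∣ʳyz; ∙-cong-∣; x∣xy; x∣ʳyx)
open import Algebra.Properties.Monoid.Divisibility (CommutativeRing.*-monoid polyRing)
  using (∣ʳ-refl; ∣ʳ-reflexive)

-- The zero test by which the ring solver discards vanishing coefficients; a list of zeros counts as
-- zero.
≈[]? : ∀ p → Maybe ([] ≈ p)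
≈[]? []      = just ≈-refl
≈[]? (a ∷ p) with a ℤ.≟ 0ℤ | ≈[]? p
... | yes a≡0 | just []≈p = just (≈-sym (∷≈[] a≡0 (≈-sym []≈p)))
... | _       | _         = nothing

polySolverRing : AlmostCommutativeRing 0ℓ 0ℓ
polySolverRing = fromCommutativeRing polyRing ≈[]?

-- Leading terms and exact division

-- The coefficient a may be zero: then p has degree less than n.
record LeadingTerm (p : Poly) (n : ℕ) (a : ℤ) : Set where
  constructor leading
  field
    top   : coeff p n ≡ a
    above : ∀ {i} → n ℕ.< i → coeff p i ≡ 0ℤ

open LeadingTerm

Monic : Poly → ℕ → Set
Monic p n = LeadingTerm p n 1ℤ

DegreeBelow : Poly → ℕ → Set
DegreeBelow p n = ∀ {i} → n ℕ.≤ i → coeff p i ≡ 0ℤ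

leading-resp-≈ : ∀ {p q n a} → p ≈ q → LeadingTerm p n a → LeadingTerm q n a
leading-resp-≈ p≈q (leading t u) =
  leading (trans (sym (coeff-≡ p≈q _)) t) λ n<i → trans (sym (coeff-≡ p≈q _)) (u n<i)

leading-+ : ∀ p {q n a} → DegreeBelow p n → LeadingTerm q n a → LeadingTerm (p + q) n a
leading-+ p {q} {n} p<n (leading t u) = leading
  (trans (coeff-+ p q n) (trans (cong₂ ℤ._+_ (p<n ℕ.≤-refl) t) (ℤ.+-identityˡ _)))
  λ {i} n<i → trans (coeff-+ p q i) (cong₂ ℤ._+_ (p<n (ℕ.<⇒≤ n<i)) (u n<i))

leading-· : ∀ c {p n a} → LeadingTerm p n a → LeadingTerm (c · p) n (c ℤ.* a)
leading-· c {p} {n} (leading t u) = leading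
  (trans (coeff-· c p n) (cong (c ℤ.*_) t))
  λ {i} n<i → trans (coeff-· c p i) (trans (cong (c ℤ.*_) (u n<i)) (ℤ.*-zeroʳ c))

leading-∷ : ∀ b {p n a} → LeadingTerm p n a → LeadingTerm (b ∷ p) (suc n) a
leading-∷ b (leading t u) = leading t λ { (s≤s n<i) → u n<i }

leading-tail : ∀ {b p n a} → LeadingTerm (b ∷ p) (suc n) a → LeadingTerm p n a
leading-tail (leading t u) = leading t λ n<i → u (s≤s n<i)

tail≈[] : ∀ {b p a} → LeadingTerm (b ∷ p) 0 a → p ≈ []
tail≈[] (leading _ u) = mk≈ λ i → u (s≤s z≤n)

leading-[] : ∀ {n} → LeadingTerm [] n 0ℤ
leading-[] = leading refl λ _ → refl

leading-* : ∀ {p q m n a b} → LeadingTerm p m a → LeadingTerm q n b →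
            LeadingTerm (p * q) (m ℕ.+ n) (a ℤ.* b)
leading-* {[]} {b = b} (leading refl _) lq = leading-[]
leading-* {c ∷ p} {q} {zero} lp@(leading refl _) lq =
  leading-resp-≈ (≈-sym cp*q≈c·q) (leading-· c lq)
  where
  cp*q≈c·q : (c ∷ p) * q ≈ c · q
  cp*q≈c·q = ≈-trans (+-congˡ (∷≈[] refl (*-cong (tail≈[] lp) (≈-refl {q})))) (+-identityʳ _)
leading-* {c ∷ p} {q} {suc m} {n} lp lq =
  -- `c · q` has degree at most `n`, below `suc m + n`, so the shifted product alone determines the
  -- leading term.
  leading-+ (c · q) (λ m+n<i → above (leading-· c lq) (ℕ.≤-trans (s≤s (ℕ.m≤n+m n m)) m+n<i))
            (leading-∷ 0ℤ (leading-* (leading-tail lp) lq))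

leading-unique : ∀ {p m n a b} → a ≢ 0ℤ → b ≢ 0ℤ → LeadingTerm p m a → LeadingTerm p n b →
                 m ≡ n × a ≡ b
leading-unique {m = m} {n} a≢0 b≢0 lm ln with ℕ.<-cmp m n
... | tri< m<n _ _  = contradiction (trans (sym (top ln)) (above lm m<n)) b≢0
... | tri≈ _ refl _ = refl , trans (sym (top lm)) (top ln)
... | tri> _ _ n<m  = contradiction (trans (sym (top lm)) (above ln n<m)) a≢0

zero-or-leading : ∀ p → p ≈ [] ⊎ ∃[ n ] ∃[ a ] (a ≢ 0ℤ × LeadingTerm p n a)
zero-or-leading []      = inj₁ ≈-refl
zero-or-leading (b ∷ p) with zero-or-leading p
... | inj₂ (n , a , a≢0 , l) = inj₂ (suc n , a , a≢0 , leading-∷ b l)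
... | inj₁ p≈[] with b ℤ.≟ 0ℤ
...   | yes b≡0 = inj₁ (∷≈[] b≡0 p≈[])
...   | no  b≢0 = inj₂ (0 , b , b≢0 , leading refl λ { {suc i} _ → coeff-≡ p≈[] i })

1≢0 : 1ℤ ≢ 0ℤ
1≢0 ()

-- A nonzero leading coefficient of `p` would reappear in `r` at degree `m + n`, against the degree
-- bound. This is what makes remainders unique.
monic-multiple-small : ∀ p {q r n} → Monic q n → DegreeBelow r n → p * q ≈ r → r ≈ []
monic-multiple-small p {q} {r} {n} mq r<n pq≈r with zero-or-leading p
... | inj₁ p≈[] = ≈-trans (≈-sym pq≈r) (*-cong p≈[] (≈-refl {q}))
... | inj₂ (m , a , a≢0 , lp) = contradiction (begin
  a                     ≡⟨ ℤ.*-identityʳ a ⟨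
  a ℤ.* 1ℤ              ≡⟨ top (leading-* lp mq) ⟨
  coeff (p * q) (m ℕ.+ n) ≡⟨ coeff-≡ pq≈r _ ⟩
  coeff r (m ℕ.+ n)     ≡⟨ r<n (ℕ.m≤n+m n m) ⟩
  0ℤ                    ∎) a≢0
  where open ≡-Reasoning

*-cancelʳ-monic : ∀ {p p′ q n} → Monic q n → p * q ≈ p′ * q → p ≈ p′
*-cancelʳ-monic {p} {p′} {q} {n} mq pq≈p′q with zero-or-leading (p - p′)
... | inj₁ p-p′≈[] = begin
  p              ≈⟨ lemma p p′ ⟩
  (p - p′) + p′  ≈⟨ +-congʳ p-p′≈[] ⟩
  p′             ∎
  where
  open ≈-Reasoning setoid
  lemma : ∀ x y → x ≈ (x - y) + y
  lemma = solve-∀ polySolverRing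
... | inj₂ (m , a , a≢0 , l) =
  contradiction (trans (sym (ℤ.*-identityʳ a)) (trans (sym (top (leading-* l mq)))
    (coeff-≡ [p-p′]q≈[] (m ℕ.+ n)))) a≢0
  where
  open ≈-Reasoning setoid
  lemma : ∀ x y z → (x - y) * z ≈ x * z - y * z
  lemma = solve-∀ polySolverRing
  [p-p′]q≈[] : (p - p′) * q ≈ []
  [p-p′]q≈[] = begin
    (p - p′) * q       ≈⟨ lemma p p′ q ⟩
    p * q - p′ * q     ≈⟨ +-congʳ pq≈p′q ⟩
    p′ * q - p′ * q    ≈⟨ -‿inverseʳ (p′ * q) ⟩
    []                 ∎

-- Leading coefficients multiply, so that of `p` times 1 equals 1.
monic-quotient : ∀ {p q m n} → Monic (p * q) m → Monic q n → ∃[ k ] Monic p k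
monic-quotient {p} {q} {m} mpq mq with zero-or-leading p
... | inj₁ p≈[] =
  contradiction (trans (sym (top mpq)) (coeff-≡ (*-cong p≈[] (≈-refl {q})) m)) 1≢0
... | inj₂ (k , a , a≢0 , lp) = k , subst (LeadingTerm p k) a≡1 lp
  where
  lpq : LeadingTerm (p * q) _ a
  lpq = subst (LeadingTerm (p * q) _) (ℤ.*-identityʳ a) (leading-* lp mq)
  a≡1 : a ≡ 1ℤ
  a≡1 = proj₂ (leading-unique a≢0 1≢0 lpq mpq)

trim-zero : ∀ {p} → p ≈ [] → trim p ≡ []
trim-zero {[]}    _    = refl
trim-zero {a ∷ p} ap≈[] rewrite trim-zero (∷≈[]⇒≈[] ap≈[])
  | coeff-≡ ap≈[] 0 = refl

length-consTrim : ∀ a p {n} → length p ≡ suc n → length (consTrim a p) ≡ suc (suc n)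
length-consTrim a (b ∷ p) eq = cong suc eq

-- Connects the computed `degree`, on which `quotRem` relies, with the degree recorded in `Monic`.
length-trim-monic : ∀ {p n} → Monic p n → length (trim p) ≡ suc n
length-trim-monic {[]}            (leading () _)
length-trim-monic {a ∷ p} {zero}  m@(leading refl _) rewrite trim-zero (tail≈[] m) = refl
length-trim-monic {a ∷ p} {suc n} m = length-consTrim a (trim p) (length-trim-monic (leading-tail m))

degree-monic : ∀ {p n} → Monic p n → degree p ≡ n
degree-monic m = cong ℕ.pred (length-trim-monic m)

quotRem-correct : ∀ {q} → Monic q (degree q) → ∀ p →
  p ≈ proj₁ (quotRem p q) * q + proj₂ (quotRem p q) × DegreeBelow (proj₂ (quotRem p q)) (degree q)
quotRem-correct mq []      = ≈-refl , λ _ → refl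
quotRem-correct {q} mq (a ∷ p) = correct , below
  where
  s r : Poly
  s = proj₁ (quotRem p q)
  r = proj₂ (quotRem p q)
  c : ℤ
  c = coeff (a ∷ r) (degree q)

  correct : a ∷ p ≈ (c ∷ s) * q + ((a ∷ r) - c · q)
  correct = begin
    a ∷ p                                      ≈⟨ ∷-cong (sym (ℤ.+-identityˡ a)) (proj₁ (quotRem-correct mq p)) ⟩
    (0ℤ ∷ s * q) + (a ∷ r)                     ≈⟨ lemma (0ℤ ∷ s * q) (a ∷ r) (c · q) ⟩
    (c · q + (0ℤ ∷ s * q)) + ((a ∷ r) - c · q) ∎
    where
    open ≈-Reasoning setoid
    lemma : ∀ x y z → x + y ≈ (z + x) + (y - z)
    lemma = solve-∀ polySolverRing

  coeff-difference : ∀ i → coeff ((a ∷ r) - c · q) i ≡ coeff (a ∷ r) i ℤ.- c ℤ.* coeff q i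
  coeff-difference i = trans (coeff-+ (a ∷ r) (-1ℤ · (c · q)) i)
    (cong (λ t → coeff (a ∷ r) i ℤ.+ t) (trans (coeff-· -1ℤ (c · q) i)
      (trans (ℤ.-1*i≡-i _) (cong ℤ.-_ (coeff-· c q i)))))

  below : DegreeBelow ((a ∷ r) - c · q) (degree q)
  below {i} n≤i with ℕ.m≤n⇒m<n∨m≡n n≤i
  ... | inj₂ refl = trans (coeff-difference i)
    (trans (cong (λ t → c ℤ.- c ℤ.* t) (top mq))
      (trans (cong (λ t → c ℤ.- t) (ℤ.*-identityʳ c)) (ℤ.+-inverseʳ c)))
  -- Here `i` is `suc j`, so the coefficient of `a ∷ r` at `i` is that of `r` at `j`, which vanishes
  -- by induction.
  ... | inj₁ n<i@(s≤s n≤j) = trans (coeff-difference i)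
    (trans (cong₂ (λ u v → u ℤ.- c ℤ.* v) (proj₂ (quotRem-correct mq p) n≤j) (above mq n<i))
      (cong (λ t → 0ℤ ℤ.- t) (ℤ.*-zeroʳ c)))

division : ∀ {q n} → Monic q n → ∀ p → ∃[ r ] (p ≈ (p quot q) * q + r × DegreeBelow r n)
division mq p with refl ← degree-monic mq = _ , quotRem-correct mq p

-- If p = t q and division gives p = s q + r, then r = (t - s) q is a multiple of q of smaller
-- degree, hence zero.
quot-exact : ∀ {p q n} → Monic q n → q ∣ p → (p quot q) * q ≈ p
quot-exact {p} {q} mq (t , tq≈p) with r , p≈sq+r , r<n ← division mq p = ≈-sym (begin
  p                 ≈⟨ p≈sq+r ⟩
  (p quot q) * q + r ≈⟨ +-congˡ (monic-multiple-small (t - p quot q) mq r<n [t-s]q≈r) ⟩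
  (p quot q) * q + [] ≈⟨ +-identityʳ _ ⟩
  (p quot q) * q     ∎)
  where
  open ≈-Reasoning setoid
  distrib-difference : ∀ x y z → (x - y) * z ≈ x * z - y * z
  distrib-difference = solve-∀ polySolverRing
  cancel : ∀ x y → (x + y) - x ≈ y
  cancel = solve-∀ polySolverRing
  [t-s]q≈r : (t - p quot q) * q ≈ r
  [t-s]q≈r = begin
    (t - p quot q) * q                          ≈⟨ distrib-difference t (p quot q) q ⟩
    t * q - (p quot q) * q                      ≈⟨ +-congʳ (≈-trans tq≈p p≈sq+r) ⟩
    ((p quot q) * q + r) - (p quot q) * q       ≈⟨ cancel ((p quot q) * q) r ⟩
    r                                           ∎

·-cancel-zero : ∀ {c p} → c ≢ 0ℤ → c · p ≈ [] → p ≈ []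
·-cancel-zero {c} {p} c≢0 cp≈[] = mk≈ λ i →
  [ (λ c≡0 → contradiction c≡0 c≢0) , (λ eq → eq) ]′
    (ℤ.i*j≡0⇒i≡0∨j≡0 c (trans (sym (coeff-· c p i)) (coeff-≡ cp≈[] i)))

-- A form of Gauss's lemma for monic divisors: if u is the remainder of r modulo q, then c u is a
-- multiple of q of small degree, so c u = 0 and u = 0. It brings divisibility over ℚ back to ℤ.
∣-·-cancel : ∀ {c q r n} → Monic q n → c ≢ 0ℤ → q ∣ c · r → q ∣ r
∣-·-cancel {c} {q} {r} {n} mq c≢0 (t , tq≈cr)
  with u , r≈sq+u , u<n ← division mq r = r quot q , ≈-sym (begin
  r                   ≈⟨ r≈sq+u ⟩
  (r quot q) * q + u  ≈⟨ +-congˡ (·-cancel-zero c≢0 (monic-multiple-small (t - C * s) mq cu<n [t-cs]q≈cu)) ⟩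
  (r quot q) * q + [] ≈⟨ +-identityʳ _ ⟩
  (r quot q) * q      ∎)
  where
  open ≈-Reasoning setoid
  s C : Poly
  s = r quot q
  C = c ∷ []
  cu<n : DegreeBelow (c · u) n
  cu<n {i} n≤i = trans (coeff-· c u i) (trans (cong (c ℤ.*_) (u<n n≤i)) (ℤ.*-zeroʳ c))
  lemma₁ : ∀ x y z w → (x - y * z) * w ≈ x * w - y * (z * w)
  lemma₁ = solve-∀ polySolverRing
  lemma₂ : ∀ x y z → x * (y + z) - x * y ≈ x * z
  lemma₂ = solve-∀ polySolverRing
  [t-cs]q≈cu : (t - C * s) * q ≈ c · u
  [t-cs]q≈cu = begin
    (t - C * s) * q                ≈⟨ lemma₁ t C s q ⟩
    t * q - C * (s * q)            ≈⟨ +-congʳ (≈-trans tq≈cr (≈-sym (constant-* c r))) ⟩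
    C * r - C * (s * q)            ≈⟨ +-congʳ (*-congˡ C r≈sq+u) ⟩
    C * (s * q + u) - C * (s * q)  ≈⟨ lemma₂ C (s * q) u ⟩
    C * u                          ≈⟨ constant-* c u ⟩
    c · u                          ∎

-- Powers of x and composition

X^-+ : ∀ m n → X^ (m ℕ.+ n) ≈ X^ m * X^ n
X^-+ zero    n = ≈-sym (*-identityˡ (X^ n))
X^-+ (suc m) n = ≈-trans (∷-cong refl (X^-+ m n)) (≈-sym (0∷-* (X^ m) (X^ n)))

monic-1ₚ : Monic 1ₚ 0
monic-1ₚ = leading refl λ { {suc i} _ → refl }

monic-X^ : ∀ n → Monic (X^ n) n
monic-X^ zero    = monic-1ₚ
monic-X^ (suc n) = leading-∷ 0ℤ (monic-X^ n)

monic-X^-1 : ∀ n → .{{NonZero n}} → Monic (X^ n - 1ₚ) n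
monic-X^-1 (suc n) = leading-resp-≈ (+-comm (-1ℤ · 1ₚ) (X^ suc n))
  (leading-+ (-1ℤ · 1ₚ) (λ { (s≤s _) → refl }) (monic-X^ (suc n)))

[0]≈[] : 0ℤ ∷ [] ≈ []
[0]≈[] = ∷≈[] refl ≈-refl

-- Composition recurses on the list, so lists of zeros are treated first, on the way to showing that
-- it respects `_≈_`.
∘-zeroˡ : ∀ {p} q → p ≈ [] → p ∘ q ≈ []
∘-zeroˡ {[]}    q _ = ≈-refl
∘-zeroˡ {a ∷ p} q ap≈[] = begin
  (a ∷ []) + q * (p ∘ q) ≈⟨ +-cong (∷≈[] (coeff-≡ ap≈[] 0) ≈-refl)
                                   (*-congˡ q (∘-zeroˡ q (∷≈[]⇒≈[] ap≈[]))) ⟩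
  q * []                 ≈⟨ *-zeroʳ q ⟩
  []                     ∎
  where open ≈-Reasoning setoid

∘-congˡ : ∀ {p p′} q → p ≈ p′ → p ∘ q ≈ p′ ∘ q
∘-congˡ {[]}    {p′}     q p≈p′ = ≈-sym (∘-zeroˡ q (≈-sym p≈p′))
∘-congˡ {a ∷ p} {[]}     q p≈p′ = ∘-zeroˡ q p≈p′
∘-congˡ {a ∷ p} {b ∷ p′} q p≈p′ =
  +-cong (∷-cong (coeff-≡ p≈p′ 0) ≈-refl)
         (*-congˡ q (∘-congˡ q (∷-injectiveʳ p≈p′)))

∘-+ : ∀ p p′ q → (p + p′) ∘ q ≈ p ∘ q + p′ ∘ q
∘-+ []      p′       q = ≈-refl
∘-+ (a ∷ p) []       q = ≈-sym (+-identityʳ _)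
∘-+ (a ∷ p) (b ∷ p′) q = begin
  ((a ∷ []) + (b ∷ [])) + q * ((p + p′) ∘ q)                 ≈⟨ +-congˡ (*-congˡ q (∘-+ p p′ q)) ⟩
  ((a ∷ []) + (b ∷ [])) + q * (p ∘ q + p′ ∘ q)               ≈⟨ lemma (a ∷ []) (b ∷ []) q (p ∘ q) (p′ ∘ q) ⟩
  ((a ∷ []) + q * (p ∘ q)) + ((b ∷ []) + q * (p′ ∘ q))       ∎
  where
  open ≈-Reasoning setoid
  lemma : ∀ x y z u v → (x + y) + z * (u + v) ≈ (x + z * u) + (y + z * v)
  lemma = solve-∀ polySolverRing

∘-· : ∀ c p q → (c · p) ∘ q ≈ c · (p ∘ q)
∘-· c []      q = ≈-refl
∘-· c (a ∷ p) q = begin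
  c · (a ∷ []) + q * ((c · p) ∘ q)     ≈⟨ +-congˡ (*-congˡ q (∘-· c p q)) ⟩
  c · (a ∷ []) + q * (c · (p ∘ q))     ≈⟨ +-congˡ (begin
    q * (c · (p ∘ q))                    ≈⟨ *-comm q (c · (p ∘ q)) ⟩
    (c · (p ∘ q)) * q                    ≈⟨ ·-*-assoc c (p ∘ q) q ⟩
    c · ((p ∘ q) * q)                    ≈⟨ ·-cong c (*-comm (p ∘ q) q) ⟩
    c · (q * (p ∘ q))                    ∎) ⟩
  c · (a ∷ []) + c · (q * (p ∘ q))     ≈⟨ ·-distribˡ-+ c (a ∷ []) (q * (p ∘ q)) ⟨
  c · ((a ∷ []) + q * (p ∘ q))         ∎
  where open ≈-Reasoning setoid

∘-* : ∀ p p′ q → (p * p′) ∘ q ≈ (p ∘ q) * (p′ ∘ q)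
∘-* []      p′ q = ≈-refl
∘-* (a ∷ p) p′ q = begin
  (a · p′ + (0ℤ ∷ p * p′)) ∘ q
    ≈⟨ ∘-+ (a · p′) (0ℤ ∷ p * p′) q ⟩
  (a · p′) ∘ q + ((0ℤ ∷ []) + q * ((p * p′) ∘ q))
    ≈⟨ +-cong (≈-trans (∘-· a p′ q) (≈-sym (constant-* a (p′ ∘ q))))
              (+-cong [0]≈[] (*-congˡ q (∘-* p p′ q))) ⟩
  (a ∷ []) * (p′ ∘ q) + q * ((p ∘ q) * (p′ ∘ q))
    ≈⟨ lemma (a ∷ []) (p′ ∘ q) q (p ∘ q) ⟩
  ((a ∷ []) + q * (p ∘ q)) * (p′ ∘ q) ∎
  where
  open ≈-Reasoning setoid
  lemma : ∀ x y z u → x * y + z * (u * y) ≈ (x + z * u) * y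
  lemma = solve-∀ polySolverRing

constant-∘ : ∀ c q → (c ∷ []) ∘ q ≈ c ∷ []
constant-∘ c q = ≈-trans (+-congˡ (*-zeroʳ q)) (+-identityʳ (c ∷ []))

∘-X^1 : ∀ p → p ∘ (X^ 1) ≈ p
∘-X^1 []      = ≈-refl
∘-X^1 (a ∷ p) = begin
  (a ∷ []) + (0ℤ ∷ 1ₚ) * (p ∘ (X^ 1)) ≈⟨ +-congˡ {x = a ∷ []} (*-congˡ (X^ 1) (∘-X^1 p)) ⟩
  (a ∷ []) + (0ℤ ∷ 1ₚ) * p            ≈⟨ +-congˡ {x = a ∷ []} (0∷-* 1ₚ p) ⟩
  (a ∷ []) + (0ℤ ∷ 1ₚ * p)            ≈⟨ ∷-cong (ℤ.+-identityʳ a) (*-identityˡ p) ⟩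
  a ∷ p                               ∎
  where open ≈-Reasoning setoid

X^-∘-X^ : ∀ m n → (X^ m) ∘ (X^ n) ≈ X^ (m ℕ.* n)
X^-∘-X^ zero    n = constant-∘ 1ℤ (X^ n)
X^-∘-X^ (suc m) n = begin
  (0ℤ ∷ []) + X^ n * ((X^ m) ∘ (X^ n)) ≈⟨ +-cong [0]≈[] (*-congˡ (X^ n) (X^-∘-X^ m n)) ⟩
  X^ n * X^ (m ℕ.* n)                  ≈⟨ X^-+ n (m ℕ.* n) ⟨
  X^ (n ℕ.+ m ℕ.* n)                   ∎
  where open ≈-Reasoning setoid

X^-1-∘-X^ : ∀ m n → (X^ m - 1ₚ) ∘ (X^ n) ≈ X^ (m ℕ.* n) - 1ₚ
X^-1-∘-X^ m n = ≈-trans (∘-+ (X^ m) (-1ℤ · 1ₚ) (X^ n))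
  (+-cong (X^-∘-X^ m n) (constant-∘ -1ℤ (X^ n)))

leading-∘-X^ : ∀ {p n a} m → .{{NonZero m}} → LeadingTerm p n a → LeadingTerm (p ∘ (X^ m)) (n ℕ.* m) a
leading-∘-X^ {[]}    m (leading refl _) = leading-[]
leading-∘-X^ {b ∷ p} {zero} m l@(leading refl _) =
  leading-resp-≈ (≈-trans (≈-sym (constant-∘ b (X^ m))) (∘-congˡ (X^ m) (∷-cong refl (≈-sym (tail≈[] l)))))
    (leading refl λ { {suc i} _ → refl })
-- Since `m` is positive, the constant `b` lies below degree `m + n * m`.
leading-∘-X^ {b ∷ p} {suc n} {a} m@(suc _) l = leading-+ (b ∷ []) (λ { (s≤s _) → refl })
  (subst (LeadingTerm (X^ m * (p ∘ (X^ m))) (m ℕ.+ n ℕ.* m)) (ℤ.*-identityˡ a)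
    (leading-* (monic-X^ m) (leading-∘-X^ m (leading-tail l))))

∣-∘ : ∀ {p q} r → p ∣ q → p ∘ r ∣ q ∘ r
∣-∘ {p} r (s , sp≈q) = s ∘ r , ≈-trans (≈-sym (∘-* s p r)) (∘-congˡ r sp≈q)

-- Ideals and coprimality

-- Covers both the multiples of one polynomial, used for greatest common divisors, and the ideals
-- with two generators, used for coprimality, so that `X^-1-gcd` serves both.
record IsIdeal (I : Pred Poly 0ℓ) : Set where
  field
    resp-≈   : ∀ {p q} → p ≈ q → I p → I q
    +-closed : ∀ {p q} → I p → I q → I (p + q)
    *-closed : ∀ p {q} → I q → I (p * q)

  difference-closed : ∀ {p q} → I p → I q → I (p - q)
  difference-closed {p} {q} p∈I q∈I =
    +-closed p∈I (resp-≈ (constant-* -1ℤ q) (*-closed (-1ℤ ∷ []) q∈I))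

  ∣-closed : ∀ {p q} → p ∣ q → I p → I q
  ∣-closed (r , rp≈q) p∈I = resp-≈ rp≈q (*-closed r p∈I)

multiples-isIdeal : ∀ p → IsIdeal (p ∣_)
multiples-isIdeal p = record
  { resp-≈   = ∣ʳ-respʳ-≈
  ; +-closed = λ { (u , eq) (v , eq′) → u + v , ≈-trans (*-distribʳ-+ p u v) (+-cong eq eq′) }
  ; *-closed = λ r → x∣ʳy⇒x∣ʳzy r
  }

⟪_,_⟫ : Poly → Poly → Pred Poly 0ℓ
⟪ p , q ⟫ r = ∃[ u ] ∃[ v ] u * p + v * q ≈ r

⟪,⟫-isIdeal : ∀ p q → IsIdeal ⟪ p , q ⟫
⟪,⟫-isIdeal p q = record
  { resp-≈   = λ { r≈s (u , v , eq) → u , v , ≈-trans eq r≈s }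
  ; +-closed = λ { (u , v , eq) (u′ , v′ , eq′) →
      u + u′ , v + v′ , ≈-trans (lemma₁ u u′ v v′ p q) (+-cong eq eq′) }
  ; *-closed = λ { r (u , v , eq) → r * u , r * v , ≈-trans (lemma₂ r u v p q) (*-congˡ r eq) }
  }
  where
  lemma₁ : ∀ u u′ v v′ p q → (u + u′) * p + (v + v′) * q ≈ (u * p + v * q) + (u′ * p + v′ * q)
  lemma₁ = solve-∀ polySolverRing
  lemma₂ : ∀ r u v p q → (r * u) * p + (r * v) * q ≈ r * (u * p + v * q)
  lemma₂ = solve-∀ polySolverRing

p∈⟪p,q⟫ : ∀ p q → ⟪ p , q ⟫ p
p∈⟪p,q⟫ p q = 1ₚ , [] , ≈-trans (+-identityʳ _) (*-identityˡ p)

q∈⟪p,q⟫ : ∀ p q → ⟪ p , q ⟫ q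
q∈⟪p,q⟫ p q = [] , 1ₚ , *-identityˡ q

-- The sum 1 + x^g + ... + x^(g(m-1)) in Horner form.
geometric : ℕ → ℕ → Poly
geometric g zero    = []
geometric g (suc m) = 1ₚ + X^ g * geometric g m

geometric-sum : ∀ g m → geometric g m * (X^ g - 1ₚ) ≈ X^ (m ℕ.* g) - 1ₚ
geometric-sum g zero    = ≈-sym (-‿inverseʳ 1ₚ)
geometric-sum g (suc m) = begin
  (1ₚ + y * s) * (y - 1ₚ)              ≈⟨ lemma₁ y s ⟩
  (y - 1ₚ) + y * (s * (y - 1ₚ))        ≈⟨ +-congˡ {x = y - 1ₚ} (*-congˡ y (geometric-sum g m)) ⟩
  (y - 1ₚ) + y * (X^ (m ℕ.* g) - 1ₚ)   ≈⟨ lemma₂ y (X^ (m ℕ.* g)) ⟩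
  y * X^ (m ℕ.* g) - 1ₚ                ≈⟨ +-congʳ (X^-+ g (m ℕ.* g)) ⟨
  X^ (g ℕ.+ m ℕ.* g) - 1ₚ              ∎
  where
  open ≈-Reasoning setoid
  y s : Poly
  y = X^ g
  s = geometric g m
  lemma₁ : ∀ y s → (1ₚ + y * s) * (y - 1ₚ) ≈ (y - 1ₚ) + y * (s * (y - 1ₚ))
  lemma₁ = solve-∀ polySolverRing
  lemma₂ : ∀ y z → (y - 1ₚ) + y * (z - 1ₚ) ≈ y * z - 1ₚ
  lemma₂ = solve-∀ polySolverRing

-- Each of the m summands is a power of x^g, hence 1 modulo x^g - 1. This is the source of the
-- nonzero integers in the coprimality statements.
geometric-mod : ∀ g m → X^ g - 1ₚ ∣ geometric g m - (ℤ.+ m ∷ [])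
geometric-mod g zero    = [] , ≈-sym [0]≈[]
geometric-mod g (suc m) with q , eq ← geometric-mod g m = s + q , (begin
  (s + q) * (y - 1ₚ)             ≈⟨ lemma₁ s q y ⟩
  s * (y - 1ₚ) + q * (y - 1ₚ)    ≈⟨ +-congˡ {x = s * (y - 1ₚ)} eq ⟩
  s * (y - 1ₚ) + (s - c)         ≈⟨ lemma₂ s y c ⟩
  (1ₚ + y * s) - (1ₚ + c)        ∎)
  where
  open ≈-Reasoning setoid
  y s c : Poly
  y = X^ g
  s = geometric g m
  c = ℤ.+ m ∷ []
  lemma₁ : ∀ s q y → (s + q) * (y - 1ₚ) ≈ s * (y - 1ₚ) + q * (y - 1ₚ)
  lemma₁ = solve-∀ polySolverRing
  lemma₂ : ∀ s y c → s * (y - 1ₚ) + (s - c) ≈ (1ₚ + y * s) - (1ₚ + c)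
  lemma₂ = solve-∀ polySolverRing

X^-1-∣ : ∀ {m n} → m ℕ.∣ n → X^ m - 1ₚ ∣ X^ n - 1ₚ
X^-1-∣ {m} (ℕ.divides k refl) = geometric m k , geometric-sum m k

module _ {I : Pred Poly 0ℓ} (isIdeal : IsIdeal I) where
  open IsIdeal isIdeal

  X^-1-difference : ∀ d n → I (X^ (d ℕ.+ n) - 1ₚ) → I (X^ n - 1ₚ) → I (X^ d - 1ₚ)
  X^-1-difference d n p q = resp-≈ (begin
    (X^ (d ℕ.+ n) - 1ₚ) - X^ d * (X^ n - 1ₚ) ≈⟨ +-congʳ (+-congʳ (X^-+ d n)) ⟩
    (X^ d * X^ n - 1ₚ) - X^ d * (X^ n - 1ₚ)  ≈⟨ lemma (X^ d) (X^ n) ⟩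
    X^ d - 1ₚ                               ∎)
    (difference-closed p (*-closed (X^ d) q))
    where
    open ≈-Reasoning setoid
    lemma : ∀ y z → (y * z - 1ₚ) - y * (z - 1ₚ) ≈ y - 1ₚ
    lemma = solve-∀ polySolverRing

  -- Bézout over the naturals gives gcd + y n = x m, or the same with the roles exchanged. Both
  -- x^(xm) - 1 and x^(yn) - 1 lie in the ideal, so a single subtraction of exponents reaches the
  -- gcd.
  X^-1-gcd : ∀ m n → I (X^ m - 1ₚ) → I (X^ n - 1ₚ) → I (X^ (ℕ.gcd m n) - 1ₚ)
  X^-1-gcd m n p q with ℕ.Bézout.identity (ℕ.gcd-GCD m n)
  ... | ℕ.Bézout.+- x y eq = X^-1-difference _ (y ℕ.* n)
    (subst (λ k → I (X^ k - 1ₚ)) (sym eq) (∣-closed (X^-1-∣ (ℕ.n∣m*n x)) p))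
    (∣-closed (X^-1-∣ (ℕ.n∣m*n y)) q)
  ... | ℕ.Bézout.-+ x y eq = X^-1-difference _ (x ℕ.* m)
    (subst (λ k → I (X^ k - 1ₚ)) (sym eq) (∣-closed (X^-1-∣ (ℕ.n∣m*n y)) q))
    (∣-closed (X^-1-∣ (ℕ.n∣m*n x)) p)

-- Coprime over ℚ, with the denominators of a Bézout identity cleared.
Coprime : Poly → Poly → Set
Coprime p q = ∃[ c ] c ≢ 0ℤ × ⟪ p , q ⟫ (c ∷ [])

coprime-sym : ∀ {p q} → Coprime p q → Coprime q p
coprime-sym {p} {q} (c , c≢0 , u , v , eq) = c , c≢0 , v , u , ≈-trans (+-comm (v * q) (u * p)) eq

coprime-∣ʳ : ∀ {p q r} → Coprime p q → r ∣ q → Coprime p r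
coprime-∣ʳ {p} {q} {r} (c , c≢0 , u , v , eq) (t , tr≈q) = c , c≢0 , u , v * t ,
  ≈-trans (+-congˡ {x = u * p} (≈-trans (*-assoc v t r) (*-congˡ v tr≈q))) eq

coprime-1ₚ : ∀ p → Coprime p 1ₚ
coprime-1ₚ p = 1ℤ , 1≢0 , q∈⟪p,q⟫ p 1ₚ

-- The two Bézout identities are multiplied: in (u p + v q)(u′ p + v′ r) every term except v v′ q r
-- contains p.
coprime-* : ∀ {p q r} → Coprime p q → Coprime p r → Coprime p (q * r)
coprime-* {p} {q} {r} (c , c≢0 , u , v , eq) (c′ , c′≢0 , u′ , v′ , eq′) =
  c ℤ.* c′ ,
  (λ cc′≡0 → [ c≢0 , c′≢0 ]′ (ℤ.i*j≡0⇒i≡0∨j≡0 c cc′≡0)) ,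
  u * (u′ * p + v′ * r) + v * q * u′ , v * v′ , (begin
    (u * (u′ * p + v′ * r) + v * q * u′) * p + (v * v′) * (q * r) ≈⟨ lemma p q r u v u′ v′ ⟩
    (u * p + v * q) * (u′ * p + v′ * r)                           ≈⟨ *-cong eq eq′ ⟩
    (c ∷ []) * (c′ ∷ [])                                          ≈⟨ constant-* c (c′ ∷ []) ⟩
    c ℤ.* c′ ∷ []                                                 ∎)
  where
  open ≈-Reasoning setoid
  lemma : ∀ p q r u v u′ v′ → (u * (u′ * p + v′ * r) + v * q * u′) * p + (v * v′) * (q * r)
                              ≈ (u * p + v * q) * (u′ * p + v′ * r)
  lemma = solve-∀ polySolverRing

-- A Bézout identity survives substitution because its right-hand side is a constant.
coprime-∘ : ∀ {p q} r → Coprime p q → Coprime (p ∘ r) (q ∘ r)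
coprime-∘ {p} {q} r (c , c≢0 , u , v , eq) = c , c≢0 , u ∘ r , v ∘ r , (begin
  (u ∘ r) * (p ∘ r) + (v ∘ r) * (q ∘ r) ≈⟨ +-cong (∘-* u p r) (∘-* v q r) ⟨
  (u * p) ∘ r + (v * q) ∘ r             ≈⟨ ∘-+ (u * p) (v * q) r ⟨
  (u * p + v * q) ∘ r                   ≈⟨ ∘-congˡ r eq ⟩
  (c ∷ []) ∘ r                          ≈⟨ constant-∘ c r ⟩
  c ∷ []                                ∎)
  where open ≈-Reasoning setoid

coprime-Φ[] : ∀ {p} Λ → (∀ {d} → d ∈ Λ → Coprime p (Φ d)) → Coprime p Φ[ Λ ]
coprime-Φ[] []      _  = coprime-1ₚ _
coprime-Φ[] (d ∷ Λ) cs = coprime-* (cs (here refl)) (coprime-Φ[] Λ (λ e∈Λ → cs (there e∈Λ)))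

coprime-divisor : ∀ {p q r n} → Monic p n → Coprime p q → p ∣ q * r → p ∣ r
coprime-divisor {p} {q} {r} mp (c , c≢0 , u , v , eq) p∣qr = ∣-·-cancel mp c≢0
  (resp-≈ (begin
    (u * r) * p + v * (q * r)  ≈⟨ lemma p q r u v ⟩
    (u * p + v * q) * r        ≈⟨ *-cong eq ≈-refl ⟩
    (c ∷ []) * r               ≈⟨ constant-* c r ⟩
    c · r                      ∎)
  (+-closed (x∣ʳyx p (u * r)) (*-closed v p∣qr)))
  where
  open ≈-Reasoning setoid
  open IsIdeal (multiples-isIdeal p)
  lemma : ∀ p q r u v → (u * r) * p + v * (q * r) ≈ (u * p + v * q) * r
  lemma = solve-∀ polySolverRing

-- Cyclotomic polynomials

-- Listed downwards to follow the recursion of `∏Φ`, with the largest divisor at the head.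
divisorsUpTo : ℕ → ℕ → List ℕ
divisorsUpTo n m = filter (ℕ._∣? n) (applyDownFrom suc m)

∏Φ≡Φ[divisors] : ∀ n m → ∏Φ n m ≡ Φ[ divisorsUpTo n m ]
∏Φ≡Φ[divisors] n zero    = refl
∏Φ≡Φ[divisors] n (suc m) with does (suc m ℕ.∣? n)
... | true  = cong (Φ (suc m) *_) (∏Φ≡Φ[divisors] n m)
... | false = ∏Φ≡Φ[divisors] n m

divisorsUpTo-unique : ∀ n m → Unique (divisorsUpTo n m)
divisorsUpTo-unique n m = Unique.filter⁺ (ℕ._∣? n)
  (Unique.applyDownFrom⁺₁ suc m λ j<i _ i≡j → ℕ.<⇒≢ j<i (sym (ℕ.suc-injective i≡j)))

∈-divisorsUpTo⁺ : ∀ {d n m} → .{{NonZero d}} → d ℕ.∣ n → d ℕ.≤ m → d ∈ divisorsUpTo n m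
∈-divisorsUpTo⁺ {suc d} {n} d∣n d≤m = ∈-filter⁺ (ℕ._∣? n) (∈-applyDownFrom⁺ suc d≤m) d∣n

∈-divisorsUpTo⁻ : ∀ {d n m} → d ∈ divisorsUpTo n m → NonZero d × d ℕ.∣ n × d ℕ.≤ m
∈-divisorsUpTo⁻ {n = n} {m} d∈ with ∈-filter⁻ (ℕ._∣? n) {xs = applyDownFrom suc m} d∈
... | d∈′ , d∣n with i , i<m , refl ← ∈-applyDownFrom⁻ suc d∈′ = _ , d∣n , i<m

divisors : ℕ → List ℕ
divisors n = divisorsUpTo n n

divisors-suc : ∀ n → divisors (suc n) ≡ suc n ∷ divisorsUpTo (suc n) n
divisors-suc n = filter-accept (ℕ._∣? suc n) {xs = applyDownFrom suc n} ℕ.∣-refl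

Φ-∣-Φ[] : ∀ {d Λ} → d ∈ Λ → Φ d ∣ Φ[ Λ ]
Φ-∣-Φ[] {d} {_ ∷ Λ} (here refl)   = x∣xy (Φ d) Φ[ Λ ]
Φ-∣-Φ[] {_} {e ∷ _} (there d∈Λ) = x∣ʳy⇒x∣ʳzy (Φ e) (Φ-∣-Φ[] d∈Λ)

-- The facts carried through the strong induction on k. `separation` says, without a quotient, that
-- Φ_k divides (x^k - 1)/(x^g - 1) for every proper divisor g of k.
record Cyclotomic (k : ℕ) : Set where
  field
    deg            : ℕ
    monic          : Monic (Φ k) deg
    factorisation  : Φ[ divisors k ] ≈ X^ k - 1ₚ
    separation     : ∀ {g} → .{{NonZero g}} → g ℕ.∣ k → g ℕ.< k →
                     Φ k * (X^ g - 1ₚ) ∣ X^ k - 1ₚ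

  Φ-∣ : .{{NonZero k}} → Φ k ∣ X^ k - 1ₚ
  Φ-∣ = ∣ʳ-respʳ-≈ factorisation (Φ-∣-Φ[] (∈-divisorsUpTo⁺ ℕ.∣-refl ℕ.≤-refl))

  -- With g = gcd(k, j), the ideal (Φ_k, x^j - 1) contains x^g - 1, and the
  -- multiple (x^k - 1)/(x^g - 1) of Φ_k, which is k/g modulo x^g - 1.
  coprime-X^-1 : .{{NonZero k}} → ∀ {j} → ¬ (k ℕ.∣ j) → Coprime (Φ k) (X^ j - 1ₚ)
  coprime-X^-1 {j} k∤j = ℤ.+ m , m≢0 , resp-≈ (cancel (geometric g m) (ℤ.+ m ∷ []))
    (difference-closed
      (∣-closed Φ∣geometric (p∈⟪p,q⟫ (Φ k) (X^ j - 1ₚ)))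
      (∣-closed (geometric-mod g m) X^g-1∈I))
    where
    open IsIdeal (⟪,⟫-isIdeal (Φ k) (X^ j - 1ₚ))
    g m : ℕ
    g = ℕ.gcd k j
    m = ℕ.quotient (ℕ.gcd[m,n]∣m k j)
    k≡mg : k ≡ m ℕ.* g
    k≡mg = ℕ._∣_.equality (ℕ.gcd[m,n]∣m k j)
    instance
      g≢0 : NonZero g
      g≢0 = ℕ.≢-nonZero (ℕ.gcd[m,n]≢0 k j (inj₁ (ℕ.≢-nonZero⁻¹ k)))
    g<k : g ℕ.< k
    g<k = ℕ.≤∧≢⇒< (ℕ.∣⇒≤ (ℕ.gcd[m,n]∣m k j))
      λ g≡k → k∤j (subst (ℕ._∣ j) g≡k (ℕ.gcd[m,n]∣n k j))
    m≢0 : ℤ.+ m ≢ 0ℤ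
    m≢0 m≡0 = ℕ.≢-nonZero⁻¹ k (trans k≡mg (cong (ℕ._* g) (ℤ.+-injective m≡0)))
    X^g-1∈I : ⟪ Φ k , X^ j - 1ₚ ⟫ (X^ g - 1ₚ)
    X^g-1∈I = X^-1-gcd (⟪,⟫-isIdeal _ _) k j
      (∣-closed Φ-∣ (p∈⟪p,q⟫ _ _)) (q∈⟪p,q⟫ (Φ k) (X^ j - 1ₚ))
    Φ∣geometric : Φ k ∣ geometric g m
    Φ∣geometric with h , eq ← separation (ℕ.gcd[m,n]∣m k j) g<k =
      h , *-cancelʳ-monic (monic-X^-1 g) (begin
        (h * Φ k) * (X^ g - 1ₚ)       ≈⟨ *-assoc h (Φ k) (X^ g - 1ₚ) ⟩
        h * (Φ k * (X^ g - 1ₚ))       ≈⟨ eq ⟩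
        X^ k - 1ₚ                     ≡⟨ cong (λ n → X^ n - 1ₚ) k≡mg ⟩
        X^ (m ℕ.* g) - 1ₚ             ≈⟨ geometric-sum g m ⟨
        geometric g m * (X^ g - 1ₚ)   ∎)
      where open ≈-Reasoning setoid
    cancel : ∀ x y → x - (x - y) ≈ y
    cancel = solve-∀ polySolverRing

open Cyclotomic

-- Distinct positive integers cannot divide each other. If i does not divide j, then Φ_i is coprime
-- to x^j - 1 and so to its divisor Φ_j. The `Cyclotomic` arguments allow use inside the induction
-- that constructs them.
Φ-coprime : ∀ {i j} .{{i≢0 : NonZero i}} .{{j≢0 : NonZero j}} → Cyclotomic i → Cyclotomic j → i ≢ j →
            Coprime (Φ i) (Φ j)
Φ-coprime {i} {j} ci cj i≢j with i ℕ.∣? j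
... | no i∤j  = coprime-∣ʳ (coprime-X^-1 ci i∤j) (Φ-∣ cj)
... | yes i∣j =
  coprime-sym (coprime-∣ʳ (coprime-X^-1 cj (λ j∣i → i≢j (ℕ.∣-antisym i∣j j∣i))) (Φ-∣ ci))

-- Write f = t q; then p divides q t and is coprime to q, so it divides t.
coprime-*-∣ : ∀ {p q f n} → Monic p n → Coprime p q → p ∣ f → q ∣ f → p * q ∣ f
coprime-*-∣ {p} {q} mp cpq p∣f (t , tq≈f) = ∣ʳ-respʳ-≈ tq≈f (x∣ʳy⇒xz∣ʳyz q
  (coprime-divisor {r = t} mp cpq (∣ʳ-respʳ-≈ (≈-trans (≈-sym tq≈f) (*-comm t q)) p∣f)))

Φ[]-∣ : ∀ {f Λ} → Unique Λ → (∀ {d} → d ∈ Λ → NonZero d × Cyclotomic d × Φ d ∣ f) → Φ[ Λ ] ∣ f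
Φ[]-∣ {f} {[]}    _              _ = f , ≈-trans (*-comm f 1ₚ) (*-identityˡ f)
Φ[]-∣ {f} {d ∷ Λ} (d∉Λ ∷ unique) h = coprime-*-∣ (monic cd) (coprime-Φ[] Λ coprime-∈) Φd∣f
  (Φ[]-∣ unique (λ e∈Λ → h (there e∈Λ)))
  where
  d≢0 : NonZero d
  d≢0 = proj₁ (h (here refl))
  cd : Cyclotomic d
  cd = proj₁ (proj₂ (h (here refl)))
  Φd∣f : Φ d ∣ f
  Φd∣f = proj₂ (proj₂ (h (here refl)))
  coprime-∈ : ∀ {e} → e ∈ Λ → Coprime (Φ d) (Φ e)
  coprime-∈ e∈Λ with e≢0 , ce , _ ← h (there e∈Λ) =
    Φ-coprime {{d≢0}} {{e≢0}} cd ce (All.lookup d∉Λ e∈Λ)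

monic-Φ[] : ∀ Λ → (∀ {d} → d ∈ Λ → Cyclotomic d) → ∃[ n ] Monic Φ[ Λ ] n
monic-Φ[] []      _  = 0 , monic-1ₚ
monic-Φ[] (d ∷ Λ) cs with n , m ← monic-Φ[] Λ (λ e∈Λ → cs (there e∈Λ)) =
  deg (cs (here refl)) ℕ.+ n , leading-* (monic (cs (here refl))) m

-- By the induction hypothesis the Φ_d over the proper divisors d of k are monic and pairwise
-- coprime divisors of x^k - 1. Their product P therefore divides it, and the division that defines
-- Φ_k is exact.
cyclotomic-step : ∀ k → .{{NonZero k}} → (∀ {d} → d ℕ.< k → .{{NonZero d}} → Cyclotomic d) → Cyclotomic k
cyclotomic-step k@(suc n) cyclotomic< = record
  { deg           = proj₁ monic-Φ
  ; monic         = proj₂ monic-Φ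
  ; factorisation = ≈-trans (≈-reflexive (cong Φ[_] (divisors-suc n))) Φ*P≈
  ; separation    = λ {g} g∣k g<k → ∣ʳ-respʳ-≈ Φ*P≈ (∙-cong-∣ (∣ʳ-refl {Φ k}) (X^-1-∣-P g∣k g<k))
  }
  where
  P : Poly
  P = Φ[ divisorsUpTo k n ]
  cyclotomic-∈ : ∀ {d} → d ∈ divisorsUpTo k n → Cyclotomic d
  cyclotomic-∈ d∈ with d≢0 , d∣k , d≤n ← ∈-divisorsUpTo⁻ d∈ = cyclotomic< (s≤s d≤n) {{d≢0}}
  monic-P : ∃[ m ] Monic P m
  monic-P = monic-Φ[] (divisorsUpTo k n) cyclotomic-∈
  P∣ : P ∣ X^ k - 1ₚ
  P∣ = Φ[]-∣ (divisorsUpTo-unique k n) λ d∈ → let d≢0 , d∣k , _ = ∈-divisorsUpTo⁻ {m = n} d∈ in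
    d≢0 , cyclotomic-∈ d∈ , ∣ʳ-trans (Φ-∣ (cyclotomic-∈ d∈) {{d≢0}}) (X^-1-∣ {n = k} d∣k)
  Φ*P≈ : Φ k * P ≈ X^ k - 1ₚ
  Φ*P≈ = subst (λ Q → ((X^ k - 1ₚ) quot Q) * P ≈ X^ k - 1ₚ) (sym (∏Φ≡Φ[divisors] k n))
    (quot-exact (proj₂ monic-P) P∣)
  monic-Φ : ∃[ m ] Monic (Φ k) m
  monic-Φ = monic-quotient (leading-resp-≈ (≈-sym Φ*P≈) (monic-X^-1 k)) (proj₂ monic-P)
  -- x^g - 1 is the product of the Φ_d over d ∣ g, and every such d is a proper divisor of k, so Φ_d
  -- is a factor of P.
  X^-1-∣-P : ∀ {g} → .{{NonZero g}} → g ℕ.∣ k → g ℕ.< k → X^ g - 1ₚ ∣ P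
  X^-1-∣-P {g} g∣k g<k@(s≤s g≤n) = ∣ʳ-respˡ-≈ (factorisation (cyclotomic< g<k))
    (Φ[]-∣ (divisorsUpTo-unique g g) λ d∈ → let d≢0 , d∣g , d≤g = ∈-divisorsUpTo⁻ d∈ in
      d≢0 ,
      cyclotomic< (ℕ.≤-<-trans d≤g g<k) {{d≢0}} ,
      Φ-∣-Φ[] (∈-divisorsUpTo⁺ {{d≢0}} (ℕ.∣-trans d∣g g∣k) (ℕ.≤-trans d≤g g≤n)))

cyclotomic : ∀ k → .{{NonZero k}} → Cyclotomic k
cyclotomic k = go (<-wellFounded k)
  where
  go : ∀ {k} → Acc ℕ._<_ k → .{{NonZero k}} → Cyclotomic k
  go (acc rs) = cyclotomic-step _ λ d<k → go (rs d<k)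

-- Cyclotomic polynomials at powers of x

coprime-Φ[]-∘ : ∀ {p} Λ q → (∀ {d} → d ∈ Λ → Coprime p (Φ d ∘ q)) → Coprime p (Φ[ Λ ] ∘ q)
coprime-Φ[]-∘ {p} []      q _  = coprime-∣ʳ (coprime-1ₚ p) (∣ʳ-reflexive (constant-∘ 1ℤ q))
coprime-Φ[]-∘     (d ∷ Λ) q cs = coprime-∣ʳ
  (coprime-* (cs (here refl)) (coprime-Φ[]-∘ Λ q (λ e∈Λ → cs (there e∈Λ))))
  (∣ʳ-reflexive (∘-* (Φ d) Φ[ Λ ] q))

Φ-∘-∣ : ∀ d m → .{{NonZero d}} → Φ d ∘ (X^ m) ∣ X^ (d ℕ.* m) - 1ₚ
Φ-∘-∣ d m = ∣ʳ-respʳ-≈ (X^-1-∘-X^ d m) (∣-∘ (X^ m) (Φ-∣ (cyclotomic d)))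

-- x^(am) - 1 is the product of the Φ_d(x^m) over d ∣ a, and Φ_(am) is coprime
-- to those with d < a, as these divide x^(dm) - 1.
Φ-*-∣ : ∀ a m → .{{NonZero a}} → .{{NonZero m}} → Φ (a ℕ.* m) ∣ Φ a ∘ (X^ m)
Φ-*-∣ a@(suc n) m = coprime-divisor {q = P ∘ (X^ m)} (monic ck) coprime-P (∣ʳ-respʳ-≈ eq (Φ-∣ ck))
  where
  k : ℕ
  k = a ℕ.* m
  instance
    k≢0 : NonZero k
    k≢0 = ℕ.m*n≢0 a m
  ck : Cyclotomic k
  ck = cyclotomic k
  P : Poly
  P = Φ[ divisorsUpTo a n ]
  eq : X^ k - 1ₚ ≈ (P ∘ (X^ m)) * (Φ a ∘ (X^ m))
  eq = begin
    X^ k - 1ₚ                       ≈⟨ X^-1-∘-X^ a m ⟨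
    (X^ a - 1ₚ) ∘ (X^ m)            ≈⟨ ∘-congˡ (X^ m) (factorisation (cyclotomic a)) ⟨
    Φ[ divisors a ] ∘ (X^ m)        ≡⟨ cong (λ Λ → Φ[ Λ ] ∘ (X^ m)) (divisors-suc n) ⟩
    (Φ a * P) ∘ (X^ m)              ≈⟨ ∘-* (Φ a) P (X^ m) ⟩
    (Φ a ∘ (X^ m)) * (P ∘ (X^ m))   ≈⟨ *-comm (Φ a ∘ (X^ m)) (P ∘ (X^ m)) ⟩
    (P ∘ (X^ m)) * (Φ a ∘ (X^ m))   ∎
    where open ≈-Reasoning setoid
  coprime-P : Coprime (Φ k) (P ∘ (X^ m))
  coprime-P = coprime-Φ[]-∘ (divisorsUpTo a n) (X^ m) λ {d} d∈ →
    let d≢0 , _ , d≤n = ∈-divisorsUpTo⁻ {m = n} d∈ in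
    coprime-∣ʳ
      -- If am divided dm, then a would divide d, but 0 < d < a.
      (coprime-X^-1 ck λ k∣dm →
        ℕ.<⇒≱ (s≤s d≤n) (ℕ.∣⇒≤ {{d≢0}} (ℕ.*-cancelʳ-∣ m k∣dm)))
      (Φ-∘-∣ d m {{d≢0}})

-- Φ_k(x^p) divides Φ_k Φ_(pk), since it divides x^(pk) - 1 and is coprime to
-- the other Φ_e with e ∣ pk, each of which divides some x^(pd) - 1 with k ∤ d.
Φ-∘-prime-∣ : ∀ {p} k → Prime p → .{{NonZero p}} → .{{NonZero k}} →
              Φ k ∘ (X^ p) ∣ Φ k * Φ (p ℕ.* k)
Φ-∘-prime-∣ {p} k p-prime = coprime-divisor {q = Φ[ Λ ]}
  (leading-∘-X^ p (monic (cyclotomic k)))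
  (coprime-Φ[] Λ coprime-∈)
  (∣ʳ-trans (Φ-∘-∣ k p) (subst (λ n → X^ n - 1ₚ ∣ Φ[ Λ ] * (Φ k * Φ pk)) (ℕ.*-comm p k)
    (∣ʳ-respˡ-≈ (factorisation (cyclotomic pk)) (Φ[]-∣ (divisorsUpTo-unique pk pk) factor))))
  where
  pk : ℕ
  pk = p ℕ.* k
  instance
    pk≢0 : NonZero pk
    pk≢0 = ℕ.m*n≢0 p k
  other? : ∀ e → Dec (e ≢ k × e ≢ pk)
  other? e = ¬? (e ℕ.≟ k) ×-dec ¬? (e ℕ.≟ pk)
  Λ : List ℕ
  Λ = filter other? (divisors pk)

  factor : ∀ {e} → e ∈ divisors pk → NonZero e × Cyclotomic e × Φ e ∣ Φ[ Λ ] * (Φ k * Φ pk)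
  factor {e} e∈ with e≢0 , _ ← ∈-divisorsUpTo⁻ {m = pk} e∈ = e≢0 , cyclotomic e {{e≢0}} , Φe∣
    where
    Φe∣ : Φ e ∣ Φ[ Λ ] * (Φ k * Φ pk)
    Φe∣ with e ℕ.≟ k | e ℕ.≟ pk
    ... | yes refl | _        = x∣ʳy⇒x∣ʳzy Φ[ Λ ] (x∣xy (Φ k) (Φ pk))
    ... | no _     | yes refl = x∣ʳy⇒x∣ʳzy Φ[ Λ ] (x∣ʳyx (Φ pk) (Φ k))
    ... | no e≢k   | no e≢pk  = ∣ʳ-trans (Φ-∣-Φ[] (∈-filter⁺ other? e∈ (e≢k , e≢pk))) (x∣xy Φ[ Λ ] (Φ k * Φ pk))

  -- Let q e = p k. If p divides e = d p, then d ∣ k, and e ≠ pk rules out k ∣ d. If p divides q,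
  -- then e ∣ k, and e ≠ k rules out k ∣ e, so d = e serves.
  cover : ∀ {e} → e ℕ.∣ pk → e ≢ k → e ≢ pk → ∃[ d ] ¬ (k ℕ.∣ d) × e ℕ.∣ d ℕ.* p
  cover {e} (ℕ.divides q pk≡qe) e≢k e≢pk
    with euclidsLemma q e p-prime (ℕ.divides k (trans (sym pk≡qe) (ℕ.*-comm p k)))
  ... | inj₂ (ℕ.divides d refl) = d , (λ k∣d → e≢pk (trans (ℕ.*-comm d p) (cong (p ℕ.*_) (ℕ.∣-antisym d∣k k∣d)))) , ℕ.∣-refl
    where
    d∣k : d ℕ.∣ k
    d∣k = ℕ.*-cancelʳ-∣ p (ℕ.divides q (trans (ℕ.*-comm k p) pk≡qe))
  ... | inj₁ (ℕ.divides t refl) = e , (λ k∣e → e≢k (ℕ.∣-antisym e∣k k∣e)) , ℕ.m∣m*n p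
    where
    e∣k : e ℕ.∣ k
    e∣k = ℕ.divides t (ℕ.*-cancelˡ-≡ k (t ℕ.* e) p (begin
      p ℕ.* k         ≡⟨ pk≡qe ⟩
      t ℕ.* p ℕ.* e   ≡⟨ cong (ℕ._* e) (ℕ.*-comm t p) ⟩
      p ℕ.* t ℕ.* e   ≡⟨ ℕ.*-assoc p t e ⟩
      p ℕ.* (t ℕ.* e) ∎))
      where open ≡-Reasoning

  coprime-∈ : ∀ {e} → e ∈ Λ → Coprime (Φ k ∘ (X^ p)) (Φ e)
  coprime-∈ {e} e∈Λ with e∈ , e≢k , e≢pk ← ∈-filter⁻ other? {xs = divisors pk} e∈Λ
    with e≢0 , e∣pk , _ ← ∈-divisorsUpTo⁻ {m = pk} e∈
    with d , k∤d , e∣dp ← cover e∣pk e≢k e≢pk =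
    -- Substituting x^p makes Φ_k(x^p) coprime to x^(dp) - 1, which Φ_e divides.
    coprime-∣ʳ (coprime-∘ (X^ p) (coprime-X^-1 (cyclotomic k) k∤d))
      (∣ʳ-respʳ-≈ (≈-sym (X^-1-∘-X^ d p))
        (∣ʳ-trans (Φ-∣ (cyclotomic e {{e≢0}}) {{e≢0}}) (X^-1-∣ e∣dp)))

-- Degrees of cyclotomic polynomials

divisor-degree : ∀ {p q m n} → Monic p m → Monic q n → p ∣ q → m ℕ.≤ n
divisor-degree {m = m} mp mq (t , tp≈q)
  with k , mt ← monic-quotient {t} (leading-resp-≈ (≈-sym tp≈q) mq) mp
  with refl , _ ← leading-unique 1≢0 1≢0 (leading-resp-≈ tp≈q (leading-* mt mp)) mq = ℕ.m≤n+m m k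

-- With m = deg Φ_k, degrees in Φ_k(x^p) ∣ Φ_k Φ_(pk) give p m ≤ m + deg Φ_(pk), so deg Φ_(pk) ≥ m
-- because p ≥ 2.
deg-prime-* : ∀ {p k} → Prime p → .{{_ : NonZero k}} → (c : Cyclotomic (p ℕ.* k)) →
              1 ℕ.≤ deg (cyclotomic k) → 1 ℕ.≤ deg c
deg-prime-* {p} {k} p-prime c 1≤m = ℕ.≤-trans 1≤m (ℕ.+-cancelˡ-≤ m _ _ (begin
  m ℕ.+ m      ≡⟨ cong (m ℕ.+_) (ℕ.+-identityʳ m) ⟨
  2 ℕ.* m      ≡⟨ ℕ.*-comm 2 m ⟩
  m ℕ.* 2      ≤⟨ ℕ.*-monoʳ-≤ m (ℕ.nonTrivial⇒n>1 p) ⟩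
  m ℕ.* p      ≤⟨ divisor-degree (leading-∘-X^ p (monic (cyclotomic k)))
                                 (leading-* (monic (cyclotomic k)) (monic c))
                                 (Φ-∘-prime-∣ k p-prime) ⟩
  m ℕ.+ deg c  ∎))
  where
  open ℕ.≤-Reasoning
  instance
    p≢0 : NonZero p
    p≢0 = prime⇒nonZero p-prime
    p≢1 : NonTrivial p
    p≢1 = prime⇒nonTrivial p-prime
  m : ℕ
  m = deg (cyclotomic k)

-- Builds k up from 1 by its prime factors, starting from Φ_1 = x - 1; each further prime keeps the
-- degree positive.
deg-positive : ∀ {k} → .{{NonZero k}} → (c : Cyclotomic k) → 1 ℕ.≤ deg c
deg-positive {k} c = go factors isFactorisation factorsPrime c
  where
  open PrimeFactorisation (factorise k)
  -- `Φ 1` evaluates to a closed list, so its leading term is read off by computation.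
  monic-Φ1 : Monic (Φ 1) 1
  monic-Φ1 = leading refl λ { (s≤s (s≤s _)) → refl }
  go : ∀ {k} ps → k ≡ ℕ.product ps → All Prime ps → (c : Cyclotomic k) → 1 ℕ.≤ deg c
  go []       refl []         c =
    ℕ.≤-reflexive (proj₁ (leading-unique 1≢0 1≢0 monic-Φ1 (monic c)))
  go (p ∷ ps) refl (pr ∷ prs) c = deg-prime-* pr c (go ps refl prs (cyclotomic (ℕ.product ps)))
    where
    instance
      product≢0 : NonZero (ℕ.product ps)
      product≢0 = productOfPrimes≢0 prs

-- Otherwise Φ_k would be coprime to Φ_Λ and yet divide Φ_Λ times 1; it would then divide 1, against
-- its positive degree.
Φ-∣-Φ[]⇒∈ : ∀ {k Λ} → .{{NonZero k}} → All NonZero Λ → Φ k ∣ Φ[ Λ ] → k ∈ Λ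
Φ-∣-Φ[]⇒∈ {k} {Λ} Λ≢0 Φ∣ with k ∈? Λ
... | yes k∈Λ = k∈Λ
... | no  k∉Λ = contradiction (divisor-degree (monic ck) monic-1ₚ Φ∣1) (ℕ.<⇒≱ (deg-positive ck))
  where
  ck : Cyclotomic k
  ck = cyclotomic k
  coprime-Φ[Λ] : Coprime (Φ k) Φ[ Λ ]
  coprime-Φ[Λ] = coprime-Φ[] Λ λ {d} d∈Λ → let d≢0 = All.lookup Λ≢0 d∈Λ in
    Φ-coprime {{j≢0 = d≢0}} ck (cyclotomic d {{d≢0}}) λ { refl → k∉Λ d∈Λ }
  Φ∣1 : Φ k ∣ 1ₚ
  Φ∣1 = coprime-divisor {q = Φ[ Λ ]} {r = 1ₚ} (monic ck) coprime-Φ[Λ]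
    (∣ʳ-trans Φ∣ (x∣xy Φ[ Λ ] 1ₚ))

-- Strong divisibility sequences

-- Λ may list the divisors of N in any order, so Φ_Λ and x^N - 1 are compared by mutual
-- divisibility, which is all that `GCD` depends on.
divisors⇒strongDivisibility : ∀ {Λ} N → .{{NonZero N}} → Unique Λ → ((_∈ Λ) ≐ ⟨ N ⟩) →
                              StrongDivisibilitySequence (λ n → Φ[ Λ ] ∘ (X^ n))
divisors⇒strongDivisibility {Λ} N unique (Λ⊆⟨N⟩ , ⟨N⟩⊆Λ) m n =
  is (f-∣ (ℕ.gcd[m,n]∣m m n) , f-∣ (ℕ.gcd[m,n]∣n m n)) λ {e} (e∣fm , e∣fn) →
    ∣ʳ-trans
      -- The exponents Nm and Nn have greatest common divisor N gcd(m, n).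
      (subst (λ k → e ∣ X^ k - 1ₚ) (sym (ℕ.c*gcd[m,n]≡gcd[cm,cn] N m n))
        (X^-1-gcd (multiples-isIdeal e) (N ℕ.* m) (N ℕ.* n)
          (∣ʳ-trans e∣fm (f-∣X^ m)) (∣ʳ-trans e∣fn (f-∣X^ n))))
      (X^-∣f (ℕ.gcd m n))
  where
  Φ[Λ]∣ : Φ[ Λ ] ∣ X^ N - 1ₚ
  Φ[Λ]∣ = Φ[]-∣ unique λ {d} d∈Λ → let d≢0 , d∣N = Λ⊆⟨N⟩ d∈Λ in
    d≢0 , cyclotomic d {{d≢0}} , ∣ʳ-trans (Φ-∣ (cyclotomic d {{d≢0}}) {{d≢0}}) (X^-1-∣ d∣N)
  ∣Φ[Λ] : X^ N - 1ₚ ∣ Φ[ Λ ]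
  ∣Φ[Λ] = ∣ʳ-respˡ-≈ (factorisation (cyclotomic N)) (Φ[]-∣ (divisorsUpTo-unique N N) λ {d} d∈ →
    let d≢0 , d∣N , _ = ∈-divisorsUpTo⁻ {m = N} d∈ in
    d≢0 , cyclotomic d {{d≢0}} , Φ-∣-Φ[] (⟨N⟩⊆Λ (d≢0 , d∣N)))
  f-∣X^ : ∀ n → Φ[ Λ ] ∘ (X^ n) ∣ X^ (N ℕ.* n) - 1ₚ
  f-∣X^ n = ∣ʳ-respʳ-≈ (X^-1-∘-X^ N n) (∣-∘ (X^ n) Φ[Λ]∣)
  X^-∣f : ∀ n → X^ (N ℕ.* n) - 1ₚ ∣ Φ[ Λ ] ∘ (X^ n)
  X^-∣f n = ∣ʳ-respˡ-≈ (X^-1-∘-X^ N n) (∣-∘ (X^ n) ∣Φ[Λ])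
  f-∣ : ∀ {d n} → d ℕ.∣ n → Φ[ Λ ] ∘ (X^ d) ∣ Φ[ Λ ] ∘ (X^ n)
  f-∣ {d} {n} d∣n = ∣ʳ-trans (f-∣X^ d) (∣ʳ-trans (X^-1-∣ (ℕ.*-monoʳ-∣ N d∣n)) (X^-∣f n))

-- Closure under least common multiples

lcm≢0 : ∀ a b → NonZero a → NonZero b → NonZero (ℕ.lcm a b)
lcm≢0 a b a≢0 b≢0 = ℕ.m*n≢0⇒n≢0 (ℕ.gcd a b)
  {{subst NonZero (sym (ℕ.gcd*lcm a b)) (ℕ.m*n≢0 a b {{a≢0}} {{b≢0}})}}

-- Dividing m and n by g = gcd(m, n) gives a common multiple l = m′ a = n′ b with lcm(a, b) = g l.
-- The lcm divides l, hence g = 1.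
lcm-cofactors-coprime : ∀ a b m n → .{{NonZero (ℕ.lcm a b)}} →
                        ℕ.lcm a b ≡ m ℕ.* a → ℕ.lcm a b ≡ n ℕ.* b → ℕ.gcd m n ≡ 1
lcm-cofactors-coprime a b m n k≡ma k≡nb
  with ℕ.divides m′ m≡m′g ← ℕ.gcd[m,n]∣m m n | ℕ.divides n′ n≡n′g ← ℕ.gcd[m,n]∣n m n =
  ℕ.∣1⇒≡1 (ℕ.*-cancelʳ-∣ l {{l≢0}} (subst₂ ℕ._∣_ k≡gl (sym (ℕ.*-identityˡ l))
    (ℕ.lcm-least (ℕ.n∣m*n m′) (ℕ.divides n′ l≡n′b))))
  where
  k g l : ℕ
  k = ℕ.lcm a b
  g = ℕ.gcd m n
  l = m′ ℕ.* a
  shift : ∀ x y → (x ℕ.* g) ℕ.* y ≡ g ℕ.* (x ℕ.* y)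
  shift x y = trans (cong (ℕ._* y) (ℕ.*-comm x g)) (ℕ.*-assoc g x y)
  k≡gl : k ≡ g ℕ.* l
  k≡gl = trans k≡ma (trans (cong (ℕ._* a) m≡m′g) (shift m′ a))
  gl≢0 : NonZero (g ℕ.* l)
  gl≢0 = subst NonZero k≡gl (ℕ.≢-nonZero (ℕ.≢-nonZero⁻¹ k))
  l≢0 : NonZero l
  l≢0 = ℕ.m*n≢0⇒n≢0 g {{gl≢0}}
  l≡n′b : l ≡ n′ ℕ.* b
  l≡n′b = ℕ.*-cancelˡ-≡ l (n′ ℕ.* b) g {{ℕ.m*n≢0⇒m≢0 g {{gl≢0}}}}
    (trans (sym k≡gl) (trans k≡nb (trans (cong (ℕ._* b) n≡n′g) (shift n′ b))))

module _ {Λ} (Λ≢0 : All NonZero Λ)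
         (strong : StrongDivisibilitySequence (λ n → Φ[ Λ ] ∘ (X^ n))) where

  lcm-closed : ∀ {a b} → a ∈ Λ → b ∈ Λ → ℕ.lcm a b ∈ Λ
  lcm-closed {a} {b} a∈Λ b∈Λ = Φ-∣-Φ[]⇒∈ Λ≢0 (∣ʳ-respʳ-≈ f-gcd≈
    (GCD.greatest (strong m n) (Φ-∣-f a∈Λ k≡ma , Φ-∣-f b∈Λ k≡nb)))
    where
    k m n : ℕ
    k = ℕ.lcm a b
    m = ℕ.quotient (ℕ.m∣lcm[m,n] a b)
    n = ℕ.quotient (ℕ.n∣lcm[m,n] a b)
    k≡ma : k ≡ m ℕ.* a
    k≡ma = ℕ._∣_.equality (ℕ.m∣lcm[m,n] a b)
    k≡nb : k ≡ n ℕ.* b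
    k≡nb = ℕ._∣_.equality (ℕ.n∣lcm[m,n] a b)
    instance
      k≢0 : NonZero k
      k≢0 = lcm≢0 a b (All.lookup Λ≢0 a∈Λ) (All.lookup Λ≢0 b∈Λ)
      m≢0 : NonZero m
      m≢0 = ℕ.m*n≢0⇒m≢0 m {{subst NonZero k≡ma k≢0}}
      n≢0 : NonZero n
      n≢0 = ℕ.m*n≢0⇒m≢0 n {{subst NonZero k≡nb k≢0}}
    -- The chain is Φ_k ∣ Φ_c(x^r) ∣ Φ_Λ(x^r), with k = c r.
    Φ-∣-f : ∀ {c r} → .{{NonZero r}} → c ∈ Λ → k ≡ r ℕ.* c → Φ k ∣ Φ[ Λ ] ∘ (X^ r)
    Φ-∣-f {c} {r} c∈Λ k≡rc = ∣ʳ-trans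
      (subst (λ i → Φ i ∣ Φ c ∘ (X^ r)) (trans (ℕ.*-comm c r) (sym k≡rc))
        (Φ-*-∣ c r {{All.lookup Λ≢0 c∈Λ}}))
      (∣-∘ (X^ r) (Φ-∣-Φ[] c∈Λ))
    -- The gcd of the two indices is 1, so this term of the sequence is Φ_Λ(x) itself.
    f-gcd≈ : Φ[ Λ ] ∘ (X^ (ℕ.gcd m n)) ≈ Φ[ Λ ]
    f-gcd≈ = subst (λ i → Φ[ Λ ] ∘ (X^ i) ≈ Φ[ Λ ])
      (sym (lcm-cofactors-coprime a b m n k≡ma k≡nb)) (∘-X^1 Φ[ Λ ])

lcm-closed⇒divisors : ∀ {Λ} → All NonZero Λ → Λ ≢ [] → Saturated Λ →
                      (∀ {a b} → a ∈ Λ → b ∈ Λ → ℕ.lcm a b ∈ Λ) →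
                      ∃[ N ] NonZero N × ((_∈ Λ) ≐ ⟨ N ⟩)
lcm-closed⇒divisors {Λ} Λ≢0 Λ≢[] saturated closed =
  N , All.lookup Λ≢0 N∈Λ ,
  (λ d∈Λ → All.lookup Λ≢0 d∈Λ , ∣foldr-lcm d∈Λ) ,
  (λ (_ , d∣N) → saturated d∣N N∈Λ)
  where
  N : ℕ
  N = foldr ℕ.lcm 1 Λ
  1∈ : ∀ {M} → M ≢ [] → Saturated M → 1 ∈ M
  1∈ {[]}    M≢[] _   = contradiction refl M≢[]
  1∈ {d ∷ M} _    sat = sat (ℕ.1∣ d) (here refl)
  -- The fold starts at 1, which a nonempty saturated Λ contains, and every partial lcm stays in Λ.
  foldr-lcm∈ : ∀ M → (∀ {d} → d ∈ M → d ∈ Λ) → foldr ℕ.lcm 1 M ∈ Λ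
  foldr-lcm∈ []      _   = 1∈ Λ≢[] saturated
  foldr-lcm∈ (d ∷ M) M⊆Λ = closed (M⊆Λ (here refl)) (foldr-lcm∈ M (λ e∈M → M⊆Λ (there e∈M)))
  N∈Λ : N ∈ Λ
  N∈Λ = foldr-lcm∈ Λ (λ d∈Λ → d∈Λ)
  ∣foldr-lcm : ∀ {d M} → d ∈ M → d ℕ.∣ foldr ℕ.lcm 1 M
  ∣foldr-lcm {d} {_ ∷ M} (here refl) = ℕ.m∣lcm[m,n] d (foldr ℕ.lcm 1 M)
  ∣foldr-lcm {d} {e ∷ M} (there d∈M) =
    ℕ.∣-trans (∣foldr-lcm d∈M) (ℕ.n∣lcm[m,n] e (foldr ℕ.lcm 1 M))

theorem6 : (Λ : List ℕ) → Unique Λ → All NonZero Λ → Λ ≢ [] → Saturated Λ →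
    StrongDivisibilitySequence (λ n → Φ[ Λ ] ∘ (X^ n)) ⇔
    (∃[ N ] NonZero N × ((_∈ Λ) ≐ ⟨ N ⟩))
theorem6 Λ unique Λ≢0 Λ≢[] saturated = mk⇔
  (λ strong → lcm-closed⇒divisors Λ≢0 Λ≢[] saturated (lcm-closed Λ≢0 strong))
  (λ (N , N≢0 , Λ≐⟨N⟩) → divisors⇒strongDivisibility N {{N≢0}} unique Λ≐⟨N⟩)
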